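{- For every $K_6$-free finite simple graph $G$ on $n$ vertices, $\alpha_{1}(G) + \tau_{B}(G) \le \frac{4403 n^2}{15000}$.
   Context: All graphs are finite, simple and undirected. A triangle-independent set in $G$ is a set of edges containing at most one edge from each triangle of $G$; $\alpha_{1}(G)$ denotes the maximum size of a triangle-independent set in $G$. $\tau_{B}(G)$ denotes the minimum size of a set of edges whose deletion from $G$ leaves a bipartite graph. $K_6$-free means $G$ contains no complete subgraph on $6$ vertices. -}

module Defs where

open import Data.Nat using (ℕ; _<_; _≤_)
open import Data.Fin using (Fin)
import Data.Fin as F
open import Data.Bool using (Bool)
open import Data.Product using (_×_; ∃; Σ-syntax)
open import Data.Sum using (_⊎_)
open import Data.List using (List; length)
open import Data.List.Membership.Propositional using (_∈_)
open import Data.List.Relation.Unary.All using (All)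
open import Data.List.Relation.Unary.Unique.Propositional using (Unique)
open import Relation.Nullary using (¬_)
open import Relation.Binary.PropositionalEquality using (_≡_; _≢_)
open import Function.Definitions using (Injective)

record Graph (n : ℕ) : Set₁ where
  field
    Adj   : Fin n → Fin n → Set
    sym   : ∀ {u v} → Adj u v → Adj v u
    irrfl : ∀ {u} → ¬ Adj u u
open Graph public

record EdgeSet {n : ℕ} (G : Graph n) : Set where
  field
    edges  : List (Fin n × Fin n)
    unique : Unique edges
    valid  : All (λ e → (Data.Product.proj₁ e F.< Data.Product.proj₂ e)
                       × Adj G (Data.Product.proj₁ e) (Data.Product.proj₂ e)) edges
open EdgeSet public

open import Data.Product using (_,_)

size : ∀ {n} {G : Graph n} → EdgeSet G → ℕ
size S = length (edges S)

_∋ₑ_─_ : ∀ {n} {G : Graph n} → EdgeSet G → Fin n → Fin n → Set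
S ∋ₑ u ─ v = ((u , v) ∈ edges S) ⊎ ((v , u) ∈ edges S)

-- Triangle-independent: at most one edge from each triangle.  Any two
-- distinct edges of a triangle share a vertex y, so this says that for no
-- triangle x y z are both xy and yz in S.
TriangleIndependent : ∀ {n} {G : Graph n} → EdgeSet G → Set
TriangleIndependent {n} {G} S =
  ∀ (x y z : Fin n) → Adj G x y → Adj G y z → Adj G x z →
    ¬ ((S ∋ₑ x ─ y) × (S ∋ₑ y ─ z))

BipartiteAfterDeleting : ∀ {n} {G : Graph n} → EdgeSet G → Set
BipartiteAfterDeleting {n} {G} D =
  ∃ λ (c : Fin n → Bool) → ∀ u v → Adj G u v → c u ≡ c v → D ∋ₑ u ─ v

IsAlpha1 : ∀ {n} → Graph n → ℕ → Set
IsAlpha1 G k =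
  (∃ λ (S : EdgeSet G) → TriangleIndependent S × size S ≡ k)
  × (∀ (S : EdgeSet G) → TriangleIndependent S → size S ≤ k)

IsTauB : ∀ {n} → Graph n → ℕ → Set
IsTauB G k =
  (∃ λ (D : EdgeSet G) → BipartiteAfterDeleting D × size D ≡ k)
  × (∀ (D : EdgeSet G) → BipartiteAfterDeleting D → k ≤ size D)

KFree : ∀ {n} → ℕ → Graph n → Set
KFree {n} t G =
  ¬ (Σ[ f ∈ (Fin t → Fin n) ] (Injective _≡_ _≡_ f
       × (∀ i j → i ≢ j → Adj G (f i) (f j))))

{-# OPTIONS --safe #-}

-- Let A be a maximum triangle-independent set, x u the A-degree of u, d u its degree and
-- e u = n − d u.  The A-neighbourhood of a vertex is independent in G, so x w ≤ e u for every
-- edge uw of A.  Hence placing the A-neighbourhood I of a vertex on one side and every other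
-- vertex on the opposite side with probability α / (α + β) leaves at most
--   ((α² + β²) m − α (α − β) D) / (α + β)²
-- uncut edges on average, where m is the number of edges and D the degree sum over I.
-- Choosing the vertex well makes D large: averaging gives n D ≥ Σ x d, and the A-neighbourhood
-- of a vertex of maximum A-degree X has D ≥ n X − X² + Σ x − Σ e.  Writing b = Σ x / n²,
-- p = Σ e / n² and D for D / n², one gets D ≥ b − p² unless X > (1 − p) n, in which case few
-- edges miss the neighbourhood, and always 4 D ≥ 3 b − p.  The weights 1:1, 3:1, 5:1 and 1:0
-- then bound α₁ + τ_B in every range of p and b, as 2 α₁ ≤ b n².

module Submission where

open import Defs hiding (sym)
open import Data.Bool using (Bool; true; false; _∧_; not)
import Data.Bool as Bool
open import Data.Fin using (Fin; zero; suc)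
import Data.Fin as F
import Data.Fin.Properties as F
open import Data.List using (List; []; _∷_; length; filter; cartesianProduct; allFin)
open import Data.List.Membership.Propositional using (_∈_)
open import Data.List.Membership.Propositional.Properties using (∈-filter⁺; ∈-cartesianProduct⁺; ∈-allFin)
import Data.List.Relation.Unary.All as All
open import Data.List.Relation.Unary.All.Properties using (all-filter; All¬⇒¬Any)
import Data.List.Relation.Unary.AllPairs as AllPairs
open import Data.List.Relation.Unary.Unique.Propositional using (Unique)
import Data.List.Relation.Unary.Unique.Propositional.Properties as Unique
open import Data.Nat
open import Data.Nat.Divisibility using (divides; m∣m*n; ∣-trans; m≤n⇒m!∣n!)
open import Data.Nat.Properties
open import Data.Nat.Tactic.RingSolver using (solve; solve-∀)
open import Data.Product using (_,_; proj₁; proj₂; ∃-syntax; _×_)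
open import Data.Product.Properties using (≡-dec)
open import Data.Sum using (inj₁; inj₂; swap)
open import Data.Vec as Vec using (Vec; lookup)
open import Effect.Monad using (RawMonad)
open import Relation.Binary.Definitions using (tri<; tri≈; tri>)
open import Relation.Binary.PropositionalEquality
open import Relation.Nullary using (Dec; yes; no; ¬_; ¬?; does; contradiction; _×-dec_; _⊎-dec_)
open import Relation.Nullary.Decidable using (decidable-stable; ¬¬-excluded-middle)
open import Relation.Nullary.Negation using (¬¬-Monad)
open import Algebra.Properties.Semiring.Sum +-*-semiring
  using (sum; sum-cong-≗; ∑-distrib-+; ∑-comm; *-distribˡ-sum; *-distribʳ-sum)

-- Linear combinations of inequalities, finite sums and indicators.

-- k (R − L) = (r − l) + s.
farkas : ∀ k .{{_ : NonZero k}} s {L R l r} → l ≤ r → L * k + r + s ≡ R * k + l → L ≤ R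
farkas k s {L} {R} {l} {r} l≤r eq = *-cancelʳ-≤ L R k (+-cancelʳ-≤ l (L * k) (R * k) (begin
  L * k + l      ≤⟨ +-monoʳ-≤ (L * k) l≤r ⟩
  L * k + r      ≤⟨ m≤m+n (L * k + r) s ⟩
  L * k + r + s  ≡⟨ eq ⟩
  R * k + l      ∎))
  where open ≤-Reasoning

infixr 5 _⊕_
infix 6 _⊛_

-- Together with `⊛` this assembles a nonnegative combination of hypotheses into the single
-- inequality that `farkas` takes; the ring solver then only checks an identity.
_⊕_ : ∀ {a b c d} → a ≤ b → c ≤ d → a + c ≤ b + d
_⊕_ = +-mono-≤

_⊛_ : ∀ {a b} → a ≤ b → ∀ k → a * k ≤ b * k
a≤b ⊛ k = *-monoˡ-≤ k a≤b

sum-mono : ∀ {n} {f g : Fin n → ℕ} → (∀ i → f i ≤ g i) → sum f ≤ sum g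
sum-mono {zero}  f≤g = z≤n
sum-mono {suc n} f≤g = +-mono-≤ (f≤g zero) (sum-mono (λ i → f≤g (suc i)))

sum-const : ∀ n k → sum {n} (λ _ → k) ≡ n * k
sum-const zero    k = refl
sum-const (suc n) k = cong (k +_) (sum-const n k)

sum² : ∀ {n} → (Fin n → Fin n → ℕ) → ℕ
sum² f = sum (λ u → sum (f u))

sum²-mono : ∀ {n} {f g : Fin n → Fin n → ℕ} → (∀ u v → f u v ≤ g u v) → sum² f ≤ sum² g
sum²-mono f≤g = sum-mono (λ u → sum-mono (f≤g u))

sum²-cong : ∀ {n} {f g : Fin n → Fin n → ℕ} → (∀ u v → f u v ≡ g u v) → sum² f ≡ sum² g
sum²-cong f≡g = sum-cong-≗ (λ u → sum-cong-≗ (f≡g u))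

sum²-+ : ∀ {n} (f g : Fin n → Fin n → ℕ) → sum² (λ u v → f u v + g u v) ≡ sum² f + sum² g
sum²-+ f g = trans (sum-cong-≗ (λ u → ∑-distrib-+ (f u) (g u)))
                   (∑-distrib-+ (λ u → sum (f u)) (λ u → sum (g u)))

sum²-*ˡ : ∀ {n} k (f : Fin n → Fin n → ℕ) → k * sum² f ≡ sum² (λ u v → k * f u v)
sum²-*ˡ k f = trans (*-distribˡ-sum k (λ u → sum (f u))) (sum-cong-≗ (λ u → *-distribˡ-sum k (f u)))

term≤sum : ∀ {n} (f : Fin n → ℕ) i → f i ≤ sum f
term≤sum f zero    = m≤m+n _ _
term≤sum f (suc i) = ≤-trans (term≤sum (λ j → f (suc j)) i) (m≤n+m _ _)

argmax : ∀ {n} (f : Fin (suc n) → ℕ) → ∃[ i ] ∀ j → f j ≤ f i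
argmax {zero}  f = zero , λ { zero → ≤-refl }
argmax {suc n} f with argmax (λ i → f (suc i))
... | i , max with ≤-total (f zero) (f (suc i))
...   | inj₁ f0≤ = suc i , λ { zero → f0≤ ; (suc j) → max j }
...   | inj₂ ≤f0 = zero , λ { zero → ≤-refl ; (suc j) → ≤-trans (max j) ≤f0 }

⟦_⟧ : ∀ {a} {A : Set a} → Dec A → ℕ
⟦ yes _ ⟧ = 1
⟦ no  _ ⟧ = 0

⟦⟧-mono : ∀ {a b} {A : Set a} {B : Set b} (A? : Dec A) (B? : Dec B) → (A → B) → ⟦ A? ⟧ ≤ ⟦ B? ⟧
⟦⟧-mono (no _)  B?      A→B = z≤n
⟦⟧-mono (yes a) (yes _) A→B = ≤-refl
⟦⟧-mono (yes a) (no ¬b) A→B = contradiction (A→B a) ¬b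

⟦⟧-cong : ∀ {a b} {A : Set a} {B : Set b} (A? : Dec A) (B? : Dec B) → (A → B) → (B → A) → ⟦ A? ⟧ ≡ ⟦ B? ⟧
⟦⟧-cong A? B? A→B B→A = ≤-antisym (⟦⟧-mono A? B? A→B) (⟦⟧-mono B? A? B→A)

⟦⟧-complement : ∀ {a} {A : Set a} (A? : Dec A) → ⟦ A? ⟧ + ⟦ ¬? A? ⟧ ≡ 1
⟦⟧-complement (yes _) = refl
⟦⟧-complement (no _)  = refl

sum-complement : ∀ {n a} {A : Fin n → Set a} (A? : ∀ u → Dec (A u)) →
                 sum (λ u → ⟦ A? u ⟧) + sum (λ u → ⟦ ¬? (A? u) ⟧) ≡ n
sum-complement {n} A? = begin
  sum (λ u → ⟦ A? u ⟧) + sum (λ u → ⟦ ¬? (A? u) ⟧)  ≡⟨ ∑-distrib-+ (λ u → ⟦ A? u ⟧) (λ u → ⟦ ¬? (A? u) ⟧) ⟨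
  sum (λ u → ⟦ A? u ⟧ + ⟦ ¬? (A? u) ⟧)             ≡⟨ sum-cong-≗ (λ u → ⟦⟧-complement (A? u)) ⟩
  sum {n} (λ _ → 1)                               ≡⟨ sum-const n 1 ⟩
  n * 1                                           ≡⟨ *-identityʳ n ⟩
  n                                               ∎
  where open ≡-Reasoning

-- Degree sums of a symmetric relation.

-- Since c = L / x and c′ = L / x′, this is x′ / x + x / x′ ≥ 2 with the denominators cleared.
rearrangement : ∀ {L c x c′ x′} .{{_ : NonZero x}} .{{_ : NonZero x′}} →
                c * x ≡ L → c′ * x′ ≡ L → L * 2 ≤ c * x′ + c′ * x
rearrangement {L} {c} {x} {c′} {x′} cx≡L c′x′≡L = *-cancelˡ-≤ (x * x′) {{m*n≢0 x x′}} (begin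
  x * x′ * (L * 2)              ≡⟨ solve (x ∷ x′ ∷ L ∷ []) ⟩
  L * (x * x′ * 2)              ≤⟨ *-monoʳ-≤ L (am-gm x x′) ⟩
  L * (x * x + x′ * x′)         ≡⟨ solve (x ∷ x′ ∷ L ∷ []) ⟩
  L * (x′ * x′) + L * (x * x)   ≡⟨ cong₂ (λ a b → a * (x′ * x′) + b * (x * x)) cx≡L c′x′≡L ⟨
  c * x * (x′ * x′) + c′ * x′ * (x * x)  ≡⟨ solve (x ∷ x′ ∷ c ∷ c′ ∷ []) ⟩
  x * x′ * (c * x′ + c′ * x)    ∎)
  where
  open ≤-Reasoning
  am-gm : ∀ x y → x * y * 2 ≤ x * x + y * y
  am-gm x y with ≤-total x y
  ... | inj₁ x≤y with m≤n⇒∃[o]m+o≡n x≤y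
  -- The premise is the trivial 0 ≤ 0; all the content is the slack k², the square of the
  -- difference.
  ...   | k , refl = farkas 1 (k * k) (z≤n {0}) (solve (x ∷ k ∷ []))
  am-gm x y | inj₂ y≤x with m≤n⇒∃[o]m+o≡n y≤x
  ...   | k , refl = farkas 1 (k * k) (z≤n {0}) (solve (y ∷ k ∷ []))

-- Supplies the cofactor n ! / m, replaced by 0 at m = 0. There only the inequality survives, which
-- is enough for vertices of degree 0.
divides-factorial : ∀ {m n} → m ≤ n → ∃[ c ] (c * m ≤ n !) × (.{{_ : NonZero m}} → c * m ≡ n !)
divides-factorial {zero}  {n} _   = 0 , z≤n , λ {{}}
divides-factorial {suc m} {n} m≤n with ∣-trans (m∣m*n (m !)) (m≤n⇒m!∣n! m≤n)
... | divides c n!≡cm = c , ≤-reflexive (sym n!≡cm) , sym n!≡cm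

module _ {n a} {A : Fin n → Fin n → Set a} (A? : ∀ u v → Dec (A u v)) (A-sym : ∀ {u v} → A u v → A v u) where

  private
    x : Fin n → ℕ
    x u = sum (λ v → ⟦ A? u v ⟧)

    ⟦A⟧-sym : ∀ u v → ⟦ A? u v ⟧ ≡ ⟦ A? v u ⟧
    ⟦A⟧-sym u v = ⟦⟧-cong (A? u v) (A? v u) A-sym A-sym

  degree-nonZero : ∀ {u v} → A u v → NonZero (x u)
  degree-nonZero {u} {v} Auv with A? u v in eq
  ... | yes _   = >-nonZero (≤-trans (≤-reflexive (cong ⟦_⟧ (sym eq))) (term≤sum (λ v → ⟦ A? u v ⟧) v))
  ... | no ¬Auv = contradiction Auv ¬Auv

  -- Averaging b u ≥ x v over the neighbours v of u gives Σ b ≥ Σ_{u~v} x v / x u, and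
  -- x v / x u + x u / x v ≥ 2.  The factor n ! clears the denominators.
  degree-sum≤ : (b : Fin n → ℕ) → (∀ {u v} → A u v → x v ≤ b u) → sum x ≤ sum b
  degree-sum≤ b x≤b = *-cancelˡ-≤ (n ! * 2) {{m*n≢0 (n !) 2 {{n !≢0}}}} (begin
    n ! * 2 * sum x                                           ≡⟨ sum²-*ˡ (n ! * 2) (λ u v → ⟦ A? u v ⟧) ⟩
    sum² (λ u v → n ! * 2 * ⟦ A? u v ⟧)                        ≤⟨ sum²-mono edge ⟩
    sum² (λ u v → ⟦ A? u v ⟧ * (c u * x v) + ⟦ A? v u ⟧ * (c v * x u)) ≡⟨ sum²-+ w (λ u v → w v u) ⟩
    sum² w + sum² (λ u v → w v u)                             ≡⟨ cong (sum² w +_) (∑-comm (λ u v → w v u)) ⟩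
    sum² w + sum² w                                           ≡⟨ cong (sum² w +_) (+-identityʳ (sum² w)) ⟨
    2 * sum² w                                                ≤⟨ *-monoʳ-≤ 2 (sum-mono vertex) ⟩
    2 * sum (λ u → n ! * b u)                                 ≡⟨ cong (2 *_) (*-distribˡ-sum (n !) b) ⟨
    2 * (n ! * sum b)                                         ≡⟨ *-assoc 2 (n !) (sum b) ⟨
    2 * n ! * sum b                                           ≡⟨ cong (_* sum b) (*-comm 2 (n !)) ⟩
    n ! * 2 * sum b                                           ∎)
    where
    open ≤-Reasoning

    x≤n : ∀ u → x u ≤ n
    x≤n u = ≤-trans (m≤m+n _ _) (≤-reflexive (sum-complement (A? u)))

    c : Fin n → ℕ
    c u = let c , _ = divides-factorial (x≤n u) in c

    cx≤n! : ∀ u → c u * x u ≤ n !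
    cx≤n! u = let _ , le , _ = divides-factorial (x≤n u) in le

    cx≡n! : ∀ u .{{_ : NonZero (x u)}} → c u * x u ≡ n !
    cx≡n! u = let _ , _ , eq = divides-factorial (x≤n u) in eq

    w : Fin n → Fin n → ℕ
    w u v = ⟦ A? u v ⟧ * (c u * x v)

    edge : ∀ u v → n ! * 2 * ⟦ A? u v ⟧ ≤ w u v + w v u
    edge u v rewrite ⟦A⟧-sym v u with A? u v
    ... | no _ = ≤-reflexive (*-zeroʳ (n ! * 2))
    ... | yes Auv = begin
      n ! * 2 * 1                    ≡⟨ *-identityʳ (n ! * 2) ⟩
      n ! * 2                        ≤⟨ rearrangement {n !} {c u} {x u} {c v} {x v} (cx≡n! u) (cx≡n! v) ⟩
      c u * x v + c v * x u          ≡⟨ cong₂ _+_ (*-identityˡ (c u * x v)) (*-identityˡ (c v * x u)) ⟨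
      1 * (c u * x v) + 1 * (c v * x u) ∎
      where instance
        _ = degree-nonZero Auv
        _ = degree-nonZero (A-sym Auv)

    vertex : ∀ u → sum (w u) ≤ n ! * b u
    vertex u = begin
      sum (w u)                              ≤⟨ sum-mono bound ⟩
      sum (λ v → ⟦ A? u v ⟧ * (c u * b u))   ≡⟨ *-distribʳ-sum (c u * b u) (λ v → ⟦ A? u v ⟧) ⟨
      x u * (c u * b u)                      ≡⟨ *-assoc (x u) (c u) (b u) ⟨
      x u * c u * b u                        ≡⟨ cong (_* b u) (*-comm (x u) (c u)) ⟩
      c u * x u * b u                        ≤⟨ *-monoˡ-≤ (b u) (cx≤n! u) ⟩
      n ! * b u                              ∎
      where
      bound : ∀ v → w u v ≤ ⟦ A? u v ⟧ * (c u * b u)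
      bound v with A? u v
      ... | no _ = z≤n
      ... | yes Auv = *-monoʳ-≤ 1 (*-monoʳ-≤ (c u) (x≤b Auv))

-- Independent biased colourings.

module BiasedColouring (α β : ℕ) where

  -- (α + β) ^ n times the expectation over independent colours that are true with
  -- probability α / (α + β).
  E : ∀ {n} → (Vec Bool n → ℕ) → ℕ
  E {zero}  F = F Vec.[]
  E {suc n} F = α * E (λ c → F (true Vec.∷ c)) + β * E (λ c → F (false Vec.∷ c))

  private
    split : ∀ n k → (α + β) ^ suc n * k ≡ α * ((α + β) ^ n * k) + β * ((α + β) ^ n * k)
    split n k = trans (*-assoc (α + β) ((α + β) ^ n) k) (*-distribʳ-+ ((α + β) ^ n * k) α β)

  -- The values found for a true and for a false first colour are each at most their conditional
  -- mean, so the smaller one is at most the weighted mean of both.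
  E-attained : ∀ {n} (F : Vec Bool n → ℕ) → ∃[ c ] (α + β) ^ n * F c ≤ E F
  E-attained {zero}  F = Vec.[] , ≤-reflexive (*-identityˡ (F Vec.[]))
  E-attained {suc n} F
    with E-attained (λ c → F (true Vec.∷ c)) | E-attained (λ c → F (false Vec.∷ c))
  ... | c , c≤ | d , d≤ with ≤-total (F (true Vec.∷ c)) (F (false Vec.∷ d))
  ...   | inj₁ c≤d = true Vec.∷ c , ≤-trans (≤-reflexive (split n (F (true Vec.∷ c))))
            (+-mono-≤ (*-monoʳ-≤ α c≤) (*-monoʳ-≤ β (≤-trans (*-monoʳ-≤ ((α + β) ^ n) c≤d) d≤)))
  ...   | inj₂ d≤c = false Vec.∷ d , ≤-trans (≤-reflexive (split n (F (false Vec.∷ d))))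
            (+-mono-≤ (*-monoʳ-≤ α (≤-trans (*-monoʳ-≤ ((α + β) ^ n) d≤c) c≤)) (*-monoʳ-≤ β d≤))

  E-+ : ∀ {n} (F G : Vec Bool n → ℕ) → E (λ c → F c + G c) ≡ E F + E G
  E-+ {zero}  F G = refl
  E-+ {suc n} F G = begin
    α * E (λ c → F (true Vec.∷ c) + G (true Vec.∷ c)) + β * E (λ c → F (false Vec.∷ c) + G (false Vec.∷ c))
      ≡⟨ cong₂ (λ a b → α * a + β * b) (E-+ (λ c → F (true Vec.∷ c)) (λ c → G (true Vec.∷ c)))
                                       (E-+ (λ c → F (false Vec.∷ c)) (λ c → G (false Vec.∷ c))) ⟩
    α * (E (λ c → F (true Vec.∷ c)) + E (λ c → G (true Vec.∷ c))) +
    β * (E (λ c → F (false Vec.∷ c)) + E (λ c → G (false Vec.∷ c)))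
      ≡⟨ interchange α β (E (λ c → F (true Vec.∷ c))) (E (λ c → G (true Vec.∷ c)))
                     (E (λ c → F (false Vec.∷ c))) (E (λ c → G (false Vec.∷ c))) ⟩
    E F + E G ∎
    where
    open ≡-Reasoning
    interchange : ∀ α β a b c d → α * (a + b) + β * (c + d) ≡ (α * a + β * c) + (α * b + β * d)
    interchange = solve-∀

  E-const : ∀ n k → E {n} (λ _ → k) ≡ (α + β) ^ n * k
  E-const zero    k = sym (*-identityˡ k)
  E-const (suc n) k = begin
    α * E {n} (λ _ → k) + β * E {n} (λ _ → k)  ≡⟨ *-distribʳ-+ (E {n} (λ _ → k)) α β ⟨
    (α + β) * E {n} (λ _ → k)                  ≡⟨ cong ((α + β) *_) (E-const n k) ⟩
    (α + β) * ((α + β) ^ n * k)                ≡⟨ *-assoc (α + β) ((α + β) ^ n) k ⟨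
    (α + β) * (α + β) ^ n * k                  ∎
    where open ≡-Reasoning

  E-sum : ∀ {n m} (F : Fin m → Vec Bool n → ℕ) → E (λ c → sum (λ i → F i c)) ≡ sum (λ i → E (F i))
  E-sum {n} {zero}  F = trans (E-const n 0) (*-zeroʳ ((α + β) ^ n))
  E-sum {n} {suc m} F = trans (E-+ (F zero) (λ c → sum (λ i → F (suc i) c)))
                              (cong (E (F zero) +_) (E-sum (λ i → F (suc i))))

  E-one-colour : ∀ {n} (H : Bool → ℕ) (u : Fin n) →
                 (α + β) * E (λ c → H (lookup c u)) ≡ (α + β) ^ n * (α * H true + β * H false)
  E-one-colour {suc n} H zero = begin
    (α + β) * (α * E {n} (λ _ → H true) + β * E {n} (λ _ → H false))
      ≡⟨ cong₂ (λ a b → (α + β) * (α * a + β * b)) (E-const n (H true)) (E-const n (H false)) ⟩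
    (α + β) * (α * ((α + β) ^ n * H true) + β * ((α + β) ^ n * H false))
      ≡⟨ collect α β ((α + β) ^ n) (H true) (H false) ⟩
    (α + β) * (α + β) ^ n * (α * H true + β * H false) ∎
    where
    open ≡-Reasoning
    collect : ∀ α β p a b → (α + β) * (α * (p * a) + β * (p * b)) ≡ (α + β) * p * (α * a + β * b)
    collect = solve-∀
  E-one-colour {suc n} H (suc u) = begin
    (α + β) * (α * e + β * e)                           ≡⟨ cong ((α + β) *_) (*-distribʳ-+ e α β) ⟨
    (α + β) * ((α + β) * e)                             ≡⟨ cong ((α + β) *_) (E-one-colour H u) ⟩
    (α + β) * ((α + β) ^ n * (α * H true + β * H false)) ≡⟨ *-assoc (α + β) ((α + β) ^ n) _ ⟨
    (α + β) * (α + β) ^ n * (α * H true + β * H false)  ∎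
    where
    open ≡-Reasoning
    e = E (λ c → H (lookup c u))

  pairMean : (Bool → Bool → ℕ) → ℕ
  pairMean H = α * (α * H true true + β * H true false) + β * (α * H false true + β * H false false)

  -- Distinct vertices have independent colours, and every other colour sums out to a factor α + β.
  -- The factor (α + β)² on the left avoids the exponent n - 2.
  E-two-colours : ∀ {n} (H : Bool → Bool → ℕ) {u v : Fin n} → u ≢ v →
                  (α + β) * (α + β) * E (λ c → H (lookup c u) (lookup c v)) ≡ (α + β) ^ n * pairMean H
  E-two-colours H {zero} {zero} u≢v = contradiction refl u≢v
  E-two-colours {suc n} H {zero} {suc v} _ = begin
    (α + β) * (α + β) * (α * E (λ c → H true (lookup c v)) + β * E (λ c → H false (lookup c v)))
      ≡⟨ distribute α β (E (λ c → H true (lookup c v))) (E (λ c → H false (lookup c v))) ⟩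
    (α + β) * (α * ((α + β) * E (λ c → H true (lookup c v))) + β * ((α + β) * E (λ c → H false (lookup c v))))
      ≡⟨ cong₂ (λ a b → (α + β) * (α * a + β * b)) (E-one-colour (H true) v) (E-one-colour (H false) v) ⟩
    (α + β) * (α * ((α + β) ^ n * (α * H true true + β * H true false)) +
               β * ((α + β) ^ n * (α * H false true + β * H false false)))
      ≡⟨ collect α β ((α + β) ^ n) (α * H true true + β * H true false) (α * H false true + β * H false false) ⟩
    (α + β) * (α + β) ^ n * pairMean H ∎
    where
    open ≡-Reasoning
    distribute : ∀ α β a b → (α + β) * (α + β) * (α * a + β * b) ≡ (α + β) * (α * ((α + β) * a) + β * ((α + β) * b))
    distribute = solve-∀
    collect : ∀ α β p a b → (α + β) * (α * (p * a) + β * (p * b)) ≡ (α + β) * p * (α * a + β * b)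
    collect = solve-∀
  E-two-colours {suc n} H {suc u} {zero} _ = begin
    (α + β) * (α + β) * (α * E (λ c → H (lookup c u) true) + β * E (λ c → H (lookup c u) false))
      ≡⟨ distribute α β (E (λ c → H (lookup c u) true)) (E (λ c → H (lookup c u) false)) ⟩
    (α + β) * (α * ((α + β) * E (λ c → H (lookup c u) true)) + β * ((α + β) * E (λ c → H (lookup c u) false)))
      ≡⟨ cong₂ (λ a b → (α + β) * (α * a + β * b)) (E-one-colour (λ a → H a true) u) (E-one-colour (λ a → H a false) u) ⟩
    (α + β) * (α * ((α + β) ^ n * (α * H true true + β * H false true)) +
               β * ((α + β) ^ n * (α * H true false + β * H false false)))
      ≡⟨ collect α β ((α + β) ^ n) (H true true) (H true false) (H false true) (H false false) ⟩
    (α + β) * (α + β) ^ n * pairMean H ∎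
    where
    open ≡-Reasoning
    distribute : ∀ α β a b → (α + β) * (α + β) * (α * a + β * b) ≡ (α + β) * (α * ((α + β) * a) + β * ((α + β) * b))
    distribute = solve-∀
    collect : ∀ α β p a b c d → (α + β) * (α * (p * (α * a + β * c)) + β * (p * (α * b + β * d))) ≡
                                (α + β) * p * (α * (α * a + β * b) + β * (α * c + β * d))
    collect = solve-∀
  E-two-colours {suc n} H {suc u} {suc v} u≢v = begin
    (α + β) * (α + β) * (α * e + β * e)   ≡⟨ regroup α β e ⟩
    (α + β) * ((α + β) * (α + β) * e)     ≡⟨ cong ((α + β) *_) (E-two-colours {n} H {u} {v} (λ { refl → u≢v refl })) ⟩
    (α + β) * ((α + β) ^ n * pairMean H)  ≡⟨ *-assoc (α + β) ((α + β) ^ n) (pairMean H) ⟨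
    (α + β) * (α + β) ^ n * pairMean H    ∎
    where
    open ≡-Reasoning
    e = E (λ c → H (lookup c u) (lookup c v))
    regroup : ∀ α β e → (α + β) * (α + β) * (α * e + β * e) ≡ (α + β) * ((α + β) * (α + β) * e)
    regroup = solve-∀

-- Cuts that separate an independent set.

module _ {n} (G : Graph n) (adj? : ∀ u v → Dec (Adj G u v)) where

  degree : Fin n → ℕ
  degree u = sum (λ v → ⟦ adj? u v ⟧)

  monochromatic : (Fin n → Bool) → ℕ
  monochromatic c = sum² (λ u v → ⟦ adj? u v ⟧ * ⟦ c u Bool.≟ c v ⟧)

  ⟦adj⟧-sym : ∀ u v → ⟦ adj? u v ⟧ ≡ ⟦ adj? v u ⟧
  ⟦adj⟧-sym u v = ⟦⟧-cong (adj? u v) (adj? v u) (Graph.sym G) (Graph.sym G)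

  module _ {I : Fin n → Set} (I? : ∀ u → Dec (I u)) where

    -- Exchanging `u` and `v` matches the two summands, so each vertex of `I` contributes its degree
    -- twice.
    sum²-incident : sum² (λ u v → ⟦ adj? u v ⟧ * (⟦ I? u ⟧ + ⟦ I? v ⟧)) ≡ sum (λ u → ⟦ I? u ⟧ * degree u) * 2
    sum²-incident = begin
      sum² (λ u v → ⟦ adj? u v ⟧ * (⟦ I? u ⟧ + ⟦ I? v ⟧))
        ≡⟨ sum²-cong (λ u v → trans (*-distribˡ-+ ⟦ adj? u v ⟧ ⟦ I? u ⟧ ⟦ I? v ⟧)
             (cong₂ _+_ (*-comm ⟦ adj? u v ⟧ ⟦ I? u ⟧)
                        (trans (cong (_* ⟦ I? v ⟧) (⟦adj⟧-sym u v)) (*-comm ⟦ adj? v u ⟧ ⟦ I? v ⟧)))) ⟩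
      sum² (λ u v → w u v + w v u)     ≡⟨ sum²-+ w (λ u v → w v u) ⟩
      sum² w + sum² (λ u v → w v u)    ≡⟨ cong (sum² w +_) (∑-comm (λ u v → w v u)) ⟩
      sum² w + sum² w                  ≡⟨ cong (sum² w +_) (+-identityʳ (sum² w)) ⟨
      2 * sum² w                       ≡⟨ *-comm 2 (sum² w) ⟩
      sum² w * 2                       ≡⟨ cong (_* 2) (sum-cong-≗ (λ u → *-distribˡ-sum ⟦ I? u ⟧ (λ v → ⟦ adj? u v ⟧))) ⟨
      sum (λ u → ⟦ I? u ⟧ * degree u) * 2 ∎
      where
      open ≡-Reasoning
      w : Fin n → Fin n → ℕ
      w u v = ⟦ I? u ⟧ * ⟦ adj? u v ⟧

    -- An ordered adjacent pair either meets `I` or lies in the square of the complement.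
    sum-degree≤ : sum degree ≤ sum (λ u → ⟦ I? u ⟧ * degree u) * 2
                               + sum (λ u → ⟦ ¬? (I? u) ⟧) * sum (λ u → ⟦ ¬? (I? u) ⟧)
    sum-degree≤ = begin
      sum degree ≤⟨ sum²-mono edge ⟩
      sum² (λ u v → ⟦ adj? u v ⟧ * (⟦ I? u ⟧ + ⟦ I? v ⟧) + z u * z v)
        ≡⟨ sum²-+ (λ u v → ⟦ adj? u v ⟧ * (⟦ I? u ⟧ + ⟦ I? v ⟧)) (λ u v → z u * z v) ⟩
      sum² (λ u v → ⟦ adj? u v ⟧ * (⟦ I? u ⟧ + ⟦ I? v ⟧)) + sum² (λ u v → z u * z v)
        ≡⟨ cong₂ _+_ sum²-incident (trans (sum-cong-≗ (λ u → sym (*-distribˡ-sum (z u) z))) (sym (*-distribʳ-sum (sum z) z))) ⟩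
      sum (λ u → ⟦ I? u ⟧ * degree u) * 2 + sum z * sum z ∎
      where
      open ≤-Reasoning
      z : Fin n → ℕ
      z u = ⟦ ¬? (I? u) ⟧
      edge : ∀ u v → ⟦ adj? u v ⟧ ≤ ⟦ adj? u v ⟧ * (⟦ I? u ⟧ + ⟦ I? v ⟧) + z u * z v
      edge u v with adj? u v | I? u | I? v
      ... | no _  | _     | _     = z≤n
      ... | yes _ | yes _ | _     = s≤s z≤n
      ... | yes _ | no _  | yes _ = s≤s z≤n
      ... | yes _ | no _  | no _  = s≤s z≤n

    module _ (independent : ∀ {u v} → I u → I v → ¬ Adj G u v) where

      -- Colour I false and every other vertex true with probability α / (α + β).
      biased-cut : ∀ α β δ .{{_ : NonZero (α + β)}} → α ≡ β + δ → ∃[ c ]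
        (α + β) * (α + β) * monochromatic c + α * δ * (sum (λ u → ⟦ I? u ⟧ * degree u) * 2)
          ≤ (α * α + β * β) * sum degree
      biased-cut α β δ α≡β+δ =
        colour (E-attained F .proj₁) ,
        *-cancelˡ-≤ p {{m^n≢0 (α + β) n}} (begin
          p * (w² * F c + α * δ * (sum (λ u → ⟦ I? u ⟧ * degree u) * 2))
            ≡⟨ cong (λ k → p * (w² * F c + α * δ * k)) sum²-incident ⟨
          p * (w² * F c + α * δ * sum² incident)
            ≡⟨ distribute p w² (F c) (α * δ) (sum² incident) ⟩
          w² * (p * F c) + p * (α * δ * sum² incident)
            ≤⟨ +-monoˡ-≤ (p * (α * δ * sum² incident)) (*-monoʳ-≤ w² (E-attained F .proj₂)) ⟩
          w² * E F + p * (α * δ * sum² incident)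
            ≡⟨ cong₂ _+_ E-expand incident-expand ⟩
          sum² (λ u v → w² * E (edge u v)) + sum² (λ u v → p * (α * δ * incident u v))
            ≡⟨ sum²-+ (λ u v → w² * E (edge u v)) (λ u v → p * (α * δ * incident u v)) ⟨
          sum² (λ u v → w² * E (edge u v) + p * (α * δ * incident u v))
            ≡⟨ sum²-cong pair ⟩
          sum² (λ u v → p * ((α * α + β * β) * ⟦ adj? u v ⟧))
            ≡⟨ sum²-*ˡ p (λ u v → (α * α + β * β) * ⟦ adj? u v ⟧) ⟨
          p * sum² (λ u v → (α * α + β * β) * ⟦ adj? u v ⟧)
            ≡⟨ cong (p *_) (sum²-*ˡ (α * α + β * β) (λ u v → ⟦ adj? u v ⟧)) ⟨
          p * ((α * α + β * β) * sum degree) ∎)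
        where
        open ≤-Reasoning
        open BiasedColouring α β
        p  = (α + β) ^ n
        w² = (α + β) * (α + β)

        colour : Vec Bool n → Fin n → Bool
        colour c u = not (does (I? u)) ∧ lookup c u

        edge : Fin n → Fin n → Vec Bool n → ℕ
        edge u v c = ⟦ adj? u v ⟧ * ⟦ colour c u Bool.≟ colour c v ⟧

        F : Vec Bool n → ℕ
        F c = monochromatic (colour c)

        c = E-attained F .proj₁

        incident : Fin n → Fin n → ℕ
        incident u v = ⟦ adj? u v ⟧ * (⟦ I? u ⟧ + ⟦ I? v ⟧)

        distribute : ∀ p w f k i → p * (w * f + k * i) ≡ w * (p * f) + p * (k * i)
        distribute = solve-∀

        E-expand : w² * E F ≡ sum² (λ u v → w² * E (edge u v))
        E-expand = trans
          (cong (w² *_) (trans (E-sum (λ u c → sum (λ v → edge u v c))) (sum-cong-≗ (λ u → E-sum (edge u)))))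
          (sum²-*ˡ w² (λ u v → E (edge u v)))

        incident-expand : p * (α * δ * sum² incident) ≡ sum² (λ u v → p * (α * δ * incident u v))
        incident-expand = trans (cong (p *_) (sum²-*ˡ (α * δ) incident)) (sum²-*ˡ p (λ u v → α * δ * incident u v))

        adj⇒≢ : ∀ {u v} → Adj G u v → u ≢ v
        adj⇒≢ uv refl = irrfl G uv

        in-out : ∀ α β δ p → α ≡ β + δ →
                 p * (α * (α * 0 + β * 1) + β * (α * 0 + β * 1)) + p * (α * δ * 1) ≡ p * ((α * α + β * β) * 1)
        in-out _ β δ p refl = solve (β ∷ δ ∷ p ∷ [])

        out-in : ∀ α β δ p → α ≡ β + δ →
                 p * (α * (α * 0 + β * 0) + β * (α * 1 + β * 1)) + p * (α * δ * 1) ≡ p * ((α * α + β * β) * 1)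
        out-in _ β δ p refl = solve (β ∷ δ ∷ p ∷ [])

        out-out : ∀ α β δ p → p * (α * (α * 1 + β * 0) + β * (α * 0 + β * 1)) + p * (α * δ * 0) ≡
                              p * ((α * α + β * β) * 1)
        out-out = solve-∀

        vanish : ∀ w p d k → w * (p * 0) + p * (d * 0) ≡ p * (k * 0)
        vanish = solve-∀

        -- An edge leaving `I` is monochromatic with probability β / (α + β), an edge outside `I`
        -- with probability (α² + β²) / (α + β)². The term α δ lifts the first to the second, as β
        -- (α + β) + α δ = α² + β².
        pair : ∀ u v → w² * E (edge u v) + p * (α * δ * incident u v) ≡ p * ((α * α + β * β) * ⟦ adj? u v ⟧)
        pair u v with adj? u v
        ... | no _ = trans (cong (λ e → w² * e + p * (α * δ * 0)) (E-const n 0)) (vanish w² p (α * δ) (α * α + β * β))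
        ... | yes uv with I? u | I? v
        ...   | yes Iu | yes Iv = contradiction uv (independent Iu Iv)
        ...   | yes _  | no _   = trans (cong (_+ p * (α * δ * 1)) (E-two-colours (λ a b → 1 * ⟦ false Bool.≟ b ⟧) (adj⇒≢ uv))) (in-out α β δ p α≡β+δ)
        ...   | no _   | yes _  = trans (cong (_+ p * (α * δ * 1)) (E-two-colours (λ a b → 1 * ⟦ a Bool.≟ false ⟧) (adj⇒≢ uv))) (out-in α β δ p α≡β+δ)
        ...   | no _   | no _   = trans (cong (_+ p * (α * δ * 0)) (E-two-colours (λ a b → 1 * ⟦ a Bool.≟ b ⟧) (adj⇒≢ uv))) (out-out α β δ p)

-- Linear programming in the densities.

-- (x − a) (b − x) ≥ 0.
chord : ∀ {a x b} → a ≤ x → x ≤ b → x * x + a * b ≤ (a + b) * x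
chord {a} {x} {b} a≤x x≤b with m≤n⇒∃[o]m+o≡n a≤x | m≤n⇒∃[o]m+o≡n x≤b
... | i , refl | j , refl = farkas 1 (i * j) (z≤n {0}) (solve (a ∷ i ∷ j ∷ []))

-- For l / k ≤ p ≤ h / k, where p = P / N, the square p² lies below its chord. This makes a
-- hypothesis with P² linear in P.
chord-bound : ∀ N P U V k l h .{{_ : NonZero N}} → N * U ≤ N * V + P * P → N * l ≤ P * k → P * k ≤ N * h →
              U * (k * k) + N * (l * h) ≤ V * (k * k) + P * ((l + h) * k)
chord-bound N P U V k l h q lo hi = *-cancelˡ-≤ N (farkas 1 0 (q ⊛ (k * k) ⊕ chord lo hi)
  (solve (N ∷ P ∷ U ∷ V ∷ k ∷ l ∷ h ∷ [])))

-- The case distinctions are in terms of p = P / N and b = B / N; the multipliers are dual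
-- solutions of the resulting linear programs.  Literals stand on the right of products because
-- _*_ recurses on its left argument, and unfolding a large literal there stalls the solver.
module Certificates {N P B D t}
  (B≤P : B ≤ P) (3B≤ : B * 3 ≤ D * 4 + P)
  (cut₁₁ : t * 4 + P ≤ N) (cut₃₁ : t * 16 + D * 6 + P * 5 ≤ N * 5)
  (cut₅₁ : t * 36 + D * 20 + P * 13 ≤ N * 13) (cut₁₀ : t * 2 + D * 2 + P ≤ N)
  where

  Goal : Set
  Goal = B * 7500 + t * 15000 ≤ N * 4403

  -- After division by N, `cut₁₁` and b ≤ p give b / 2 + t ≤ (1 + p) / 4 ≤ 0.2925; the target is
  -- 4403 / 15000 ≈ 0.2935.
  p≤17 : P * 1000 ≤ N * 170 → Goal
  p≤17 p = farkas 4 (N * 62) (B≤P ⊛ 30000 ⊕ cut₁₁ ⊛ 15000 ⊕ p ⊛ 15) (solve (N ∷ P ∷ B ∷ t ∷ []))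

  -- Eliminating D by `3B≤`, the weights 5:1 bound b / 2 + t by (13 - 8 p + 3 b) / 36 and 1:0 by 1 /
  -- 2 - (p + b) / 4. One grows with b and the other falls; at p = 0.45 they cross near b = 0.38.
  p≥45 : N * 450 ≤ P * 1000 → Goal
  p≥45 p with ≤-total (B * 100) (N * 38)
  ... | inj₁ b = farkas 6 (N * 68) (cut₅₁ ⊛ 2500 ⊕ 3B≤ ⊛ 12500 ⊕ b ⊛ 75 ⊕ p ⊛ 20)
                   (solve (N ∷ P ∷ B ∷ D ∷ t ∷ []))
  ... | inj₂ b = farkas 4 (N * 62) (cut₁₀ ⊛ 30000 ⊕ 3B≤ ⊛ 15000 ⊕ b ⊛ 150 ⊕ p ⊛ 15)
                   (solve (N ∷ P ∷ B ∷ D ∷ t ∷ []))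

  module _ .{{_ : NonZero N}} where

    -- With D ≥ b - p², the weights 3:1 bound b / 2 + t by (5 - 5 p + 2 b + 6 p²) / 16 and 5:1 by
    -- (13 - 13 p - 2 b + 20 p²) / 36. The first suffices with b ≤ p up to p = 0.35; beyond that,
    -- large b needs the second.
    quadratic-gain : N * B ≤ N * D + P * P → N * 170 ≤ P * 1000 → P * 1000 ≤ N * 450 → Goal
    quadratic-gain q lo hi with ≤-total (P * 1000) (N * 350)
    ... | inj₁ p = farkas 1600 (N * 17300)
                     (c ⊛ 9 ⊕ cut₃₁ ⊛ 1500000 ⊕ B≤P ⊛ 3000000 ⊕ p ⊛ 180)
                     (solve (N ∷ P ∷ B ∷ D ∷ t ∷ []))
      where
      c : B * 1000000 + N * 59500 ≤ D * 1000000 + P * 520000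
      c = chord-bound N P B D 1000 170 350 q lo p
    ... | inj₂ p with ≤-total (B * 100) (N * 34)
    ...   | inj₁ b = farkas 1600 (N * 44300)
                       (c ⊛ 9 ⊕ cut₃₁ ⊛ 1500000 ⊕ B≤P ⊛ 300000 ⊕ b ⊛ 27000)
                       (solve (N ∷ P ∷ B ∷ D ∷ t ∷ []))
      where
      c : B * 1000000 + N * 157500 ≤ D * 1000000 + P * 800000
      c = chord-bound N P B D 1000 350 450 q p hi
    ...   | inj₂ b = farkas 120 (N * 2360)
                       (c ⊕ cut₅₁ ⊛ 50000 ⊕ b ⊛ 1000 ⊕ hi ⊛ 150)
                       (solve (N ∷ P ∷ B ∷ D ∷ t ∷ []))
      where
      c : B * 1000000 + N * 157500 ≤ D * 1000000 + P * 800000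
      c = chord-bound N P B D 1000 350 450 q p hi

    -- Here `cut₁₀` gives t ≤ p² / 2, hence the bound (b + p²) / 2, besides 1 / 2 - (b + p) / 4 from
    -- `3B≤`. On b = p they agree at p = √2 - 1 ≈ 0.414, which explains 0.414 and its double 0.828.
    few-edges-missed : ∀ M → M + P ≡ N → N * M ≤ N * (D * 2) + P * P → P * 1000 ≤ N * 450 → Goal
    few-edges-missed M refl q hi with ≤-total (B * 1000 + P * 1000) (N * 828)
    ... | inj₂ b = farkas 4 (N * 32) (cut₁₀ ⊛ 30000 ⊕ 3B≤ ⊛ 15000 ⊕ b ⊛ 15)
                     (solve (M ∷ P ∷ B ∷ D ∷ t ∷ []))
    -- The upper bounds p and 0.828 - p on b cross at p = 0.414.
    ... | inj₁ b with ≤-total (P * 1000) (N * 414)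
    ...   | inj₁ p = farkas 400 (N * 5012)
                       (cut₁₀ ⊛ 3000000 ⊕ c ⊛ 3 ⊕ B≤P ⊛ 3000000 ⊕ p ⊛ 4242)
                       (solve (M ∷ P ∷ B ∷ D ∷ t ∷ []))
      where
      c : M * 1000000 + N * 0 ≤ D * 2 * 1000000 + P * 414000
      c = chord-bound N P M (D * 2) 1000 0 414 q (≤-trans (≤-reflexive (*-zeroʳ N)) z≤n) p
    ...   | inj₂ p = farkas 400 (N * 5012)
                       (cut₁₀ ⊛ 3000000 ⊕ c ⊛ 3 ⊕ b ⊛ 3000 ⊕ p ⊛ 408)
                       (solve (M ∷ P ∷ B ∷ D ∷ t ∷ []))
      where
      c : M * 1000000 + N * 186300 ≤ D * 2 * 1000000 + P * 864000
      c = chord-bound N P M (D * 2) 1000 414 450 q p hi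

-- Ranges of the maximum A-degree.

module Optimise {n X Z P B M D t}
  (X+Z≡n : X + Z ≡ n) (M+P≡n² : M + P ≡ n * n) (B≤P : B ≤ P) (3B≤ : B * 3 ≤ D * 4 + P)
  (average : n * B ≤ n * D + X * P)
  (neighbourhood : n * X + B ≤ D + P + X * X)
  (M≤ : M ≤ D * 2 + Z * Z)
  (cut₁₁ : t * 4 ≤ M) (cut₃₁ : t * 16 + D * 6 ≤ M * 5)
  (cut₅₁ : t * 36 + D * 20 ≤ M * 13) (cut₁₀ : t * 2 + D * 2 ≤ M)
  where

  private
    +P : ∀ {l} k → l ≤ M * k → l + P * k ≤ n * n * k
    +P {l} k l≤ = begin
      l + P * k      ≤⟨ +-monoˡ-≤ (P * k) l≤ ⟩
      M * k + P * k  ≡⟨ *-distribʳ-+ k M P ⟨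
      (M + P) * k    ≡⟨ cong (_* k) M+P≡n² ⟩
      n * n * k      ∎
      where open ≤-Reasoning

    +P₁ : ∀ {l} → l ≤ M → l + P ≤ n * n
    +P₁ {l} l≤ = ≤-trans (+-monoˡ-≤ P l≤) (≤-reflexive M+P≡n²)

  open Certificates {n * n} {P} {B} {D} {t} B≤P 3B≤ (+P₁ cut₁₁) (+P 5 cut₃₁) (+P 13 cut₅₁) (+P₁ cut₁₀)

  small-X : n * X ≤ P → n * n * B ≤ n * n * D + P * P
  small-X nX≤P = farkas 1 0 (average ⊛ n ⊕ nX≤P ⊛ P) (solve (n ∷ X ∷ P ∷ B ∷ D ∷ []))

  -- After scaling by n², `chord` says n X (n² - n X) ≥ P M; what remains, n² P - P M, is exactly P²
  -- since n² = M + P.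
  medium-X : P ≤ n * X → n * X ≤ M → n * n * B ≤ n * n * D + P * P
  medium-X P≤nX nX≤M = farkas 1 0
    (neighbourhood ⊛ (n * n) ⊕ chord P≤nX nX≤M ⊕
     ≤-reflexive M+P≡n² ⊛ (n * X) ⊕ ≤-reflexive (sym M+P≡n²) ⊛ P)
    (solve (n ∷ X ∷ P ∷ M ∷ B ∷ D ∷ []))

  -- The complement of the neighbourhood has Z ≤ P / n vertices, so the term Z² of `M≤` is at most
  -- P² / n².
  large-X : M ≤ n * X → n * n * M ≤ n * n * (D * 2) + P * P
  large-X M≤nX = farkas 1 0 (M≤ ⊛ (n * n) ⊕ nZ≤P ⊛ (n * Z) ⊕ nZ≤P ⊛ P) (solve (n ∷ Z ∷ P ∷ M ∷ D ∷ []))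
    where
    nZ≤P : n * Z ≤ P
    nZ≤P = farkas 1 0 (M≤nX ⊕ ≤-reflexive (sym M+P≡n²) ⊕ ≤-reflexive X+Z≡n ⊛ n)
      (solve (n ∷ X ∷ Z ∷ P ∷ M ∷ []))

  bound : B * 7500 + t * 15000 ≤ n * n * 4403
  bound with ≤-total (P * 1000) (n * n * 170) | ≤-total (n * n * 450) (P * 1000)
  ... | inj₁ p  | _      = p≤17 p
  ... | inj₂ _  | inj₁ p = p≥45 p
  ... | inj₂ lo | inj₂ hi with n * n ≟ 0
  -- The later branches cancel n², so the degenerate case is sent to small p, where P = 0 belongs.
  ...   | yes n²≡0 = p≤17 (≤-trans (≤-reflexive (cong (_* 1000) P≡0)) z≤n)
    where
    P≡0 : P ≡ 0
    P≡0 = m+n≡0⇒n≡0 M (trans M+P≡n² n²≡0)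
  ...   | no n²≢0 with ≤-total (n * X) P | ≤-total (n * X) M
  ...     | inj₁ p | _      = quadratic-gain {{≢-nonZero n²≢0}} (small-X p) lo hi
  ...     | inj₂ p | inj₁ q = quadratic-gain {{≢-nonZero n²≢0}} (medium-X p q) lo hi
  ...     | inj₂ _ | inj₂ q = few-edges-missed {{≢-nonZero n²≢0}} M M+P≡n² (large-X q) hi

-- Degree inequalities for a triangle-independent set.

module _ {m} (G : Graph (suc m)) (adj? : ∀ u v → Dec (Adj G u v))
  {A : Fin (suc m) → Fin (suc m) → Set} (A? : ∀ u v → Dec (A u v))
  (A-sym : ∀ {u v} → A u v → A v u) (A⊆G : ∀ {u v} → A u v → Adj G u v)
  (A-indep : ∀ {u v w} → A v u → A v w → ¬ Adj G u w)
  (t : ℕ) (t≤ : ∀ c → t * 2 ≤ monochromatic G adj? c)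
  where

  private
    n : ℕ
    n = suc m

    d e x D : Fin n → ℕ
    d = degree G adj?
    e u = sum (λ v → ⟦ ¬? (adj? u v) ⟧)
    x u = sum (λ v → ⟦ A? u v ⟧)
    D v = sum (λ u → ⟦ A? v u ⟧ * d u)

    -- All cuts are made at `v₂`; lower bounds on the degree sum at `v₁` carry over because `D v₁`
    -- is at most `D*`.
    v₁ = argmax x .proj₁
    v₂ = argmax D .proj₁

    X = x v₁
    Z = sum (λ u → ⟦ ¬? (A? v₁ u) ⟧)
    D* = D v₂
    -- These sums run over ordered pairs, so `B` and `M` count each edge twice.
    B = sum x
    P = sum e
    M = sum d

    d+e≡n : ∀ u → d u + e u ≡ n
    d+e≡n u = sum-complement (adj? u)

    x≤d : ∀ u → x u ≤ d u
    x≤d u = sum-mono (λ v → ⟦⟧-mono (A? u v) (adj? u v) A⊆G)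

    x+e≤n : ∀ u → x u + e u ≤ n
    x+e≤n u = ≤-trans (+-monoˡ-≤ (e u) (x≤d u)) (≤-reflexive (d+e≡n u))

    -- All A-neighbours of `w` are nonadjacent to `u`, which is one of them; accordingly `e u`
    -- counts `u` itself.
    x≤e : ∀ {u w} → A u w → x w ≤ e u
    x≤e {u} {w} Auw = sum-mono (λ v → ⟦⟧-mono (A? w v) (¬? (adj? u v)) (A-indep (A-sym Auw)))

    M+P≡n² : M + P ≡ n * n
    M+P≡n² = begin
      M + P                  ≡⟨ ∑-distrib-+ d e ⟨
      sum (λ u → d u + e u)  ≡⟨ sum-cong-≗ d+e≡n ⟩
      sum {n} (λ _ → n)      ≡⟨ sum-const n n ⟩
      n * n                  ∎
      where open ≡-Reasoning

    B≤P : B ≤ P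
    B≤P = degree-sum≤ A? A-sym e x≤e

    -- Double counting: by symmetry of `A` the left side is the sum of `D` over all vertices.
    sum-xd≤ : sum (λ u → x u * d u) ≤ n * D*
    sum-xd≤ = begin
      sum (λ u → x u * d u)                    ≡⟨ sum-cong-≗ (λ u → *-distribʳ-sum (d u) (λ v → ⟦ A? u v ⟧)) ⟩
      sum² (λ u v → ⟦ A? u v ⟧ * d u)           ≡⟨ ∑-comm (λ u v → ⟦ A? u v ⟧ * d u) ⟩
      sum² (λ v u → ⟦ A? u v ⟧ * d u)           ≡⟨ sum²-cong (λ v u → cong (_* d u) (⟦⟧-cong (A? u v) (A? v u) A-sym A-sym)) ⟩
      sum D                                    ≤⟨ sum-mono (argmax D .proj₂) ⟩
      sum {n} (λ _ → D*)                       ≡⟨ sum-const n D* ⟩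
      n * D*                                   ∎
      where open ≤-Reasoning

    -- Split n as d u + e u, and replace x u by its maximum X only in the product with e u.
    average : n * B ≤ n * D* + X * P
    average = begin
      n * B                                              ≡⟨ *-distribˡ-sum n x ⟩
      sum (λ u → n * x u)                                ≡⟨ sum-cong-≗ (λ u → cong (_* x u) (d+e≡n u)) ⟨
      sum (λ u → (d u + e u) * x u)                      ≤⟨ sum-mono pointwise ⟩
      sum (λ u → x u * d u + X * e u)                    ≡⟨ ∑-distrib-+ (λ u → x u * d u) (λ u → X * e u) ⟩
      sum (λ u → x u * d u) + sum (λ u → X * e u)        ≡⟨ cong (sum (λ u → x u * d u) +_) (*-distribˡ-sum X e) ⟨
      sum (λ u → x u * d u) + X * P                      ≤⟨ +-monoˡ-≤ (X * P) sum-xd≤ ⟩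
      n * D* + X * P                                     ∎
      where
      open ≤-Reasoning
      pointwise : ∀ u → (d u + e u) * x u ≤ x u * d u + X * e u
      pointwise u = begin
        (d u + e u) * x u      ≡⟨ *-comm (d u + e u) (x u) ⟩
        x u * (d u + e u)      ≡⟨ *-distribˡ-+ (x u) (d u) (e u) ⟩
        x u * d u + x u * e u  ≤⟨ +-monoʳ-≤ (x u * d u) (*-monoˡ-≤ (e u) (argmax x .proj₂ u)) ⟩
        x u * d u + X * e u    ∎

    -- From x + e ≤ n and 4 x e ≤ (x + e)².
    weighted : ∀ {n x d e} → d + e ≡ n → x ≤ d → n * (x * 3) ≤ x * d * 4 + n * e
    weighted {x = x} {e = e} refl x≤d with m≤n⇒∃[o]m+o≡n x≤d | ≤-total x e
    ... | k , refl | inj₁ x≤e with m≤n⇒∃[o]m+o≡n x≤e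
    ...   | j , refl = farkas 1 (j * j + k * x + k * (x + j)) (z≤n {0}) (solve (x ∷ j ∷ k ∷ []))
    weighted {x = x} {e = e} refl x≤d | k , refl | inj₂ e≤x with m≤n⇒∃[o]m+o≡n e≤x
    ...   | j , refl = farkas 1 (j * j + k * e + k * (e + j)) (z≤n {0}) (solve (e ∷ j ∷ k ∷ []))

    3B≤ : B * 3 ≤ D* * 4 + P
    3B≤ = *-cancelˡ-≤ n (begin
      n * (B * 3)                                     ≡⟨ cong (n *_) (*-distribʳ-sum 3 x) ⟩
      n * sum (λ u → x u * 3)                         ≡⟨ *-distribˡ-sum n (λ u → x u * 3) ⟩
      sum (λ u → n * (x u * 3))                       ≤⟨ sum-mono (λ u → weighted (d+e≡n u) (x≤d u)) ⟩
      sum (λ u → x u * d u * 4 + n * e u)             ≡⟨ ∑-distrib-+ (λ u → x u * d u * 4) (λ u → n * e u) ⟩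
      sum (λ u → x u * d u * 4) + sum (λ u → n * e u) ≡⟨ cong₂ _+_ (*-distribʳ-sum 4 (λ u → x u * d u)) (*-distribˡ-sum n e) ⟨
      sum (λ u → x u * d u) * 4 + n * P               ≤⟨ +-monoˡ-≤ (n * P) (*-monoˡ-≤ 4 sum-xd≤) ⟩
      n * D* * 4 + n * P                              ≡⟨ cong (_+ n * P) (*-assoc n D* 4) ⟩
      n * (D* * 4) + n * P                            ≡⟨ *-distribˡ-+ n (D* * 4) P ⟨
      n * (D* * 4 + P)                                ∎)
      where open ≤-Reasoning

    D₁≤D* : D v₁ ≤ D*
    D₁≤D* = argmax D .proj₂ v₁

    -- Apply degree-sum≤ to e with its values on the neighbourhood of v₁ lowered to X.
    neighbourhood : n * X + B ≤ D* + P + X * X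
    neighbourhood = begin
      n * X + B                                                     ≤⟨ +-monoʳ-≤ (n * X) (degree-sum≤ A? A-sym e′ x≤e′) ⟩
      n * X + sum e′                                                ≡⟨ cong (_+ sum e′) (*-distribˡ-sum n i) ⟩
      sum (λ u → n * i u) + sum e′                                  ≡⟨ ∑-distrib-+ (λ u → n * i u) e′ ⟨
      sum (λ u → n * i u + e′ u)                                    ≡⟨ sum-cong-≗ pointwise ⟩
      sum (λ u → i u * d u + e u + X * i u)                         ≡⟨ ∑-distrib-+ (λ u → i u * d u + e u) (λ u → X * i u) ⟩
      sum (λ u → i u * d u + e u) + sum (λ u → X * i u)             ≡⟨ cong₂ _+_ (∑-distrib-+ (λ u → i u * d u) e) (sym (*-distribˡ-sum X i)) ⟩
      D v₁ + P + X * X                                              ≤⟨ +-monoˡ-≤ (X * X) (+-monoˡ-≤ P D₁≤D*) ⟩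
      D* + P + X * X                                                ∎
      where
      open ≤-Reasoning
      i e′ : Fin n → ℕ
      i u = ⟦ A? v₁ u ⟧
      e′ u with A? v₁ u
      ... | yes _ = X
      ... | no  _ = e u

      x≤e′ : ∀ {u w} → A u w → x w ≤ e′ u
      x≤e′ {u} {w} Auw with A? v₁ u
      ... | yes _ = argmax x .proj₂ w
      ... | no  _ = x≤e Auw

      inside : ∀ d e X → (d + e) * 1 + X ≡ 1 * d + e + X * 1
      inside = solve-∀

      outside : ∀ n d e X → n * 0 + e ≡ 0 * d + e + X * 0
      outside = solve-∀

      -- Inside the neighbourhood, n = d u + e u restores the e u that `e′` replaced by X.
      pointwise : ∀ u → n * i u + e′ u ≡ i u * d u + e u + X * i u
      pointwise u with A? v₁ u
      ... | yes _ = trans (cong (λ k → k * 1 + X) (sym (d+e≡n u))) (inside (d u) (e u) X)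
      ... | no  _ = outside n (d u) (e u) X

    M≤ : M ≤ D* * 2 + Z * Z
    M≤ = ≤-trans (sum-degree≤ G adj? (A? v₁)) (+-monoˡ-≤ (Z * Z) (*-monoˡ-≤ 2 D₁≤D*))

    -- The separated set is the A-neighbourhood of `v₂`. The factors 2 account for both orders of an
    -- edge.
    cut : ∀ α β δ .{{_ : NonZero (α + β)}} → α ≡ β + δ →
          (α + β) * (α + β) * (t * 2) + α * δ * (D* * 2) ≤ (α * α + β * β) * M
    cut α β δ α≡β+δ = let c , bound = biased-cut G adj? (A? v₂) A-indep α β δ α≡β+δ in
      ≤-trans (+-monoˡ-≤ (α * δ * (D* * 2)) (*-monoʳ-≤ ((α + β) * (α + β)) (t≤ c))) bound

    cut₁₁ : t * 4 ≤ M
    cut₁₁ = farkas 2 0 (cut 1 1 0 refl) (eq t D* M)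
      where
      eq : ∀ t d m → t * 4 * 2 + 2 * m + 0 ≡ m * 2 + (4 * (t * 2) + 0 * (d * 2))
      eq = solve-∀

    cut₃₁ : t * 16 + D* * 6 ≤ M * 5
    cut₃₁ = farkas 2 0 (cut 3 1 2 refl) (eq t D* M)
      where
      eq : ∀ t d m → (t * 16 + d * 6) * 2 + 10 * m + 0 ≡ m * 5 * 2 + (16 * (t * 2) + 6 * (d * 2))
      eq = solve-∀

    cut₅₁ : t * 36 + D* * 20 ≤ M * 13
    cut₅₁ = farkas 2 0 (cut 5 1 4 refl) (eq t D* M)
      where
      eq : ∀ t d m → (t * 36 + d * 20) * 2 + 26 * m + 0 ≡ m * 13 * 2 + (36 * (t * 2) + 20 * (d * 2))
      eq = solve-∀

    cut₁₀ : t * 2 + D* * 2 ≤ M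
    cut₁₀ = farkas 1 0 (cut 1 0 1 refl) (eq t D* M)
      where
      eq : ∀ t d m → (t * 2 + d * 2) * 1 + 1 * m + 0 ≡ m * 1 + (1 * (t * 2) + 1 * (d * 2))
      eq = solve-∀

  density-bound : sum² (λ u v → ⟦ A? u v ⟧) * 7500 + t * 15000 ≤ n * n * 4403
  density-bound = Optimise.bound {n} {X} {Z} {P} {B} {M} {D*} {t} (sum-complement (A? v₁)) M+P≡n² B≤P 3B≤ average neighbourhood M≤
    cut₁₁ cut₃₁ cut₅₁ cut₁₀

-- Edge lists as relations on ordered pairs.

infix 4 _∈?_
_∈?_ : ∀ {n} (e : Fin n × Fin n) (es : List (Fin n × Fin n)) → Dec (e ∈ es)
_∈?_ = DecMembership._∈?_
  where import Data.List.Membership.DecPropositional (≡-dec F._≟_ F._≟_) as DecMembership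

length≤sum² : ∀ {n} {es : List (Fin n × Fin n)} → Unique es → length es ≤ sum² (λ u v → ⟦ (u , v) ∈? es ⟧)
length≤sum² AllPairs.[] = z≤n
length≤sum² {n} {(a , b) ∷ es} (e∉ AllPairs.∷ unique) = begin
  1 + length es
    ≤⟨ +-mono-≤ 1≤ (length≤sum² unique) ⟩
  sum² (λ u v → ⟦ here? u v ⟧) + sum² (λ u v → ⟦ (u , v) ∈? es ⟧)
    ≡⟨ sum²-+ (λ u v → ⟦ here? u v ⟧) (λ u v → ⟦ (u , v) ∈? es ⟧) ⟨
  sum² (λ u v → ⟦ here? u v ⟧ + ⟦ (u , v) ∈? es ⟧)
    ≤⟨ sum²-mono disjoint ⟩
  sum² (λ u v → ⟦ (u , v) ∈? (a , b) ∷ es ⟧) ∎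
  where
  open ≤-Reasoning
  here? : ∀ u v → Dec ((u , v) ≡ (a , b))
  here? u v = ≡-dec F._≟_ F._≟_ (u , v) (a , b)

  ⟦⟧-yes : ∀ {p} {A : Set p} (A? : Dec A) → A → 1 ≤ ⟦ A? ⟧
  ⟦⟧-yes (yes _) _ = ≤-refl
  ⟦⟧-yes (no ¬a) a = contradiction a ¬a

  1≤ : 1 ≤ sum² (λ u v → ⟦ here? u v ⟧)
  1≤ = ≤-trans (⟦⟧-yes (here? a b) refl)
         (≤-trans (term≤sum (λ v → ⟦ here? a v ⟧) b) (term≤sum (λ u → sum (λ v → ⟦ here? u v ⟧)) a))

  disjoint : ∀ u v → ⟦ here? u v ⟧ + ⟦ (u , v) ∈? es ⟧ ≤ ⟦ (u , v) ∈? (a , b) ∷ es ⟧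
  disjoint u v with here? u v | (u , v) ∈? es
  ... | yes refl | yes e∈ = contradiction e∈ (All¬⇒¬Any e∉)
  ... | yes refl | no _   = ≤-refl
  ... | no _     | yes _  = ≤-refl
  ... | no _     | no _   = z≤n

-- Listed pairs are increasing, so a pair and its reverse are never both listed, and each edge
-- yields two ordered pairs of `R`.
size*2≤ : ∀ {n} {G : Graph n} (S : EdgeSet G) {R : Fin n → Fin n → Set} (R? : ∀ u v → Dec (R u v)) →
          (∀ {u v} → S ∋ₑ u ─ v → R u v) → size S * 2 ≤ sum² (λ u v → ⟦ R? u v ⟧)
size*2≤ S R? S⊆R = begin
  size S * 2                                  ≡⟨ *-comm (size S) 2 ⟩
  size S + (size S + 0)                       ≡⟨ cong (size S +_) (+-identityʳ (size S)) ⟩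
  size S + size S                             ≤⟨ +-mono-≤ (length≤sum² (unique S)) (length≤sum² (unique S)) ⟩
  sum² w + sum² w                             ≡⟨ cong (sum² w +_) (∑-comm w) ⟩
  sum² w + sum² (λ u v → w v u)               ≡⟨ sum²-+ w (λ u v → w v u) ⟨
  sum² (λ u v → w u v + w v u)                ≤⟨ sum²-mono pointwise ⟩
  sum² (λ u v → ⟦ R? u v ⟧)                   ∎
  where
  open ≤-Reasoning
  w : Fin _ → Fin _ → ℕ
  w u v = ⟦ (u , v) ∈? edges S ⟧

  pointwise : ∀ u v → w u v + w v u ≤ ⟦ R? u v ⟧
  pointwise u v with (u , v) ∈? edges S | (v , u) ∈? edges S | R? u v
  ... | yes uv | yes vu | _      = contradiction (All.lookup (valid S) uv .proj₁)
                                     (F.<-asym (All.lookup (valid S) vu .proj₁))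
  ... | yes _  | no _   | yes _  = ≤-refl
  ... | yes uv | no _   | no ¬r  = contradiction (S⊆R (inj₁ uv)) ¬r
  ... | no _   | yes _  | yes _  = ≤-refl
  ... | no _   | yes vu | no ¬r  = contradiction (S⊆R (inj₂ vu)) ¬r
  ... | no _   | no _   | _      = z≤n

∋ₑ⇒Adj : ∀ {n} {G : Graph n} (S : EdgeSet G) {u v} → S ∋ₑ u ─ v → Adj G u v
∋ₑ⇒Adj {G = G} S (inj₁ uv) = All.lookup (valid S) uv .proj₂
∋ₑ⇒Adj {G = G} S (inj₂ vu) = Graph.sym G (All.lookup (valid S) vu .proj₂)

module _ {n} (G : Graph n) (adj? : ∀ u v → Dec (Adj G u v)) (c : Fin n → Bool) where

  private
    Mono : Fin n × Fin n → Set
    Mono (u , v) = u F.< v × Adj G u v × c u ≡ c v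

    mono? : ∀ e → Dec (Mono e)
    mono? (u , v) = u F.<? v ×-dec adj? u v ×-dec c u Bool.≟ c v

    pairs : List (Fin n × Fin n)
    pairs = cartesianProduct (allFin n) (allFin n)

  monochromaticEdges : EdgeSet G
  monochromaticEdges .edges  = filter mono? pairs
  monochromaticEdges .unique = Unique.filter⁺ mono? (Unique.cartesianProduct⁺ (Unique.allFin⁺ n) (Unique.allFin⁺ n))
  monochromaticEdges .valid  = All.map (λ (u<v , uv , _) → u<v , uv) (all-filter mono? pairs)

  monochromaticEdges-bipartite : BipartiteAfterDeleting monochromaticEdges
  monochromaticEdges-bipartite = c , deleted
    where
    deleted : ∀ u v → Adj G u v → c u ≡ c v → monochromaticEdges ∋ₑ u ─ v
    deleted u v uv cu≡cv with F.<-cmp u v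
    ... | tri< u<v _ _ = inj₁ (∈-filter⁺ mono? (∈-cartesianProduct⁺ (∈-allFin u) (∈-allFin v)) (u<v , uv , cu≡cv))
    ... | tri≈ _ refl _ = contradiction uv (irrfl G)
    ... | tri> _ _ v<u = inj₂ (∈-filter⁺ mono? (∈-cartesianProduct⁺ (∈-allFin v) (∈-allFin u))
                                (v<u , Graph.sym G uv , sym cu≡cv))

  size-monochromaticEdges : size monochromaticEdges * 2 ≤ monochromatic G adj? c
  size-monochromaticEdges = begin
    size monochromaticEdges * 2                                ≤⟨ size*2≤ monochromaticEdges same? same ⟩
    sum² (λ u v → ⟦ same? u v ⟧)                               ≡⟨ sum²-cong (λ u v → ⟦⟧-× (adj? u v) (c u Bool.≟ c v)) ⟩
    monochromatic G adj? c                                     ∎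
    where
    open ≤-Reasoning
    same? : ∀ u v → Dec (Adj G u v × c u ≡ c v)
    same? u v = adj? u v ×-dec c u Bool.≟ c v

    ⟦⟧-× : ∀ {A B : Set} (A? : Dec A) (B? : Dec B) → ⟦ A? ×-dec B? ⟧ ≡ ⟦ A? ⟧ * ⟦ B? ⟧
    ⟦⟧-× (no _)  _       = refl
    ⟦⟧-× (yes _) (no _)  = refl
    ⟦⟧-× (yes _) (yes _) = refl

    same : ∀ {u v} → monochromaticEdges ∋ₑ u ─ v → Adj G u v × c u ≡ c v
    same (inj₁ uv) = All.lookup (all-filter mono? pairs) uv .proj₂
    same (inj₂ vu) = let _ , adj , eq = All.lookup (all-filter mono? pairs) vu in Graph.sym G adj , sym eq

-- Deciding adjacency, and the conclusion.

-- `Adj` is an arbitrary relation. Double negation commutes with finite products, and the final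
-- inequality is decidable, hence stable, so adjacency may be taken as decidable while proving it.
¬¬-decidable : ∀ {n} (R : Fin n → Fin n → Set) → ¬ ¬ (∀ u v → Dec (R u v))
¬¬-decidable R = sequence (λ u → sequence (λ v → ¬¬-excluded-middle))
  where
  sequence : ∀ {n} {P : Fin n → Set} → (∀ i → ¬ ¬ P i) → ¬ ¬ (∀ i → P i)
  sequence = F.sequence (RawMonad.rawApplicative ¬¬-Monad)

size-empty : ∀ {G : Graph 0} (S : EdgeSet G) → size S ≡ 0
size-empty S with edges S
... | [] = refl

theorem5p2 : ∀ (n : ℕ) (G : Graph n) → KFree 6 G →
    ∀ (a t : ℕ) → IsAlpha1 G a → IsTauB G t →
    15000 * (a + t) ≤ 4403 * (n * n)
-- Without vertices there is no maximum to take; both edge sets are empty.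
theorem5p2 zero    G _ _ _ ((S , _ , refl) , _) ((D , _ , refl) , _) =
  ≤-reflexive (cong₂ (λ a t → 15000 * (a + t)) (size-empty S) (size-empty D))
theorem5p2 (suc m) G _ _ t ((S , triangle-indep , refl) , _) (_ , t-min) =
  decidable-stable (15000 * (size S + t) ≤? 4403 * (suc m * suc m))
    (λ ¬bound → ¬¬-decidable (Adj G) (λ adj? → ¬bound (bound adj?)))
  where
  _∋ₑ?_ : ∀ u v → Dec (S ∋ₑ u ─ v)
  u ∋ₑ? v = (u , v) ∈? edges S ⊎-dec (v , u) ∈? edges S

  indep : ∀ {u v w} → S ∋ₑ v ─ u → S ∋ₑ v ─ w → ¬ Adj G u w
  indep {u} {v} {w} vu vw uw =
    -- An edge uw would close a triangle with both vu and vw in `S`.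
    triangle-indep u v w (Graph.sym G (∋ₑ⇒Adj S vu)) (∋ₑ⇒Adj S vw) uw (swap vu , vw)

  bound : (∀ u v → Dec (Adj G u v)) → 15000 * (size S + t) ≤ 4403 * (suc m * suc m)
  bound adj? = begin
    15000 * (size S + t)                                     ≡⟨ regroup (size S) t ⟩
    size S * 2 * 7500 + t * 15000                            ≤⟨ +-monoˡ-≤ (t * 15000) (*-monoˡ-≤ 7500 (size*2≤ S _∋ₑ?_ (λ uv → uv))) ⟩
    sum² (λ u v → ⟦ u ∋ₑ? v ⟧) * 7500 + t * 15000            ≤⟨ density-bound G adj? _∋ₑ?_ swap (∋ₑ⇒Adj S) indep t t≤ ⟩
    suc m * suc m * 4403                                     ≡⟨ *-comm (suc m * suc m) 4403 ⟩
    4403 * (suc m * suc m)                                   ∎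
    where
    open ≤-Reasoning
    regroup : ∀ s t → 15000 * (s + t) ≡ s * 2 * 7500 + t * 15000
    regroup s t = trans (*-comm 15000 (s + t)) (trans (*-distribʳ-+ 15000 s t) (cong (_+ t * 15000) (sym (*-assoc s 2 7500))))

    t≤ : ∀ c → t * 2 ≤ monochromatic G adj? c
    -- Deleting the monochromatic edges of any `c` leaves a bipartite graph, so the minimality of
    -- `t` applies.
    t≤ c = ≤-trans (*-monoˡ-≤ 2 (t-min (monochromaticEdges G adj? c) (monochromaticEdges-bipartite G adj? c)))
                   (size-monochromaticEdges G adj? c)
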